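{- Let $G$ be a finite cyclic group with $|G| = n \ge 2$, and let $p$ be a prime divisor of $|G|$. Then $\nu (G) = \nu _p (G) = \mathsf d (G)-1$.
   Context: For a finite abelian group $G$ (written additively) let $G^{\bullet} = G\setminus\{0\}$. A sequence over $G$ is a finite unordered sequence of elements of $G$ with repetition allowed (an element of the free abelian monoid with basis $G$, written multiplicatively; the empty sequence is allowed); $|T|$ is the length of $T$, and $\Sigma(T)$ is the set of all sums of nonempty subsequences of $T$. $T$ is zero-sum free if $0\notin\Sigma(T)$. $\mathsf d(G)$ is the maximal length of a zero-sum free sequence over $G$. For nontrivial $G$, $\nu(G)$ is the smallest integer $\ell\ge 0$ such that for every zero-sum free sequence $T$ over $G$ with $|T|\ge \ell$ there are a subgroup $H\subsetneq G$ and some $\alpha\in G\setminus H$ with $G^{\bullet}\setminus\Sigma(T)\subseteq\alpha+H$. For a prime divisor $p$ of $|G|$, $\nu_p(G)$ is the smallest integer $\ell\ge 0$ such that for every zero-sum free sequence $T$ over $G$ with $|T|\ge\ell$ there are a subgroup $H\subseteq G$ with index $(G:H)=p$ and some $\alpha\in G\setminus H$ with $G^{\bullet}\setminus\Sigma(T)\subseteq\alpha+H$. -}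

module Defs where

open import Level using (Level; _⊔_) renaming (suc to lsuc)
open import Algebra.Bundles using (AbelianGroup)
import Algebra.Definitions.RawMonoid as RawMonoidDefinitions
import Algebra.Properties.AbelianGroup as AbelianGroupProperties
open import Data.Fin.Base using (Fin)
open import Data.Integer.Base using (ℤ; +_; -[1+_])
open import Data.List.Base using (List; []; foldr; length)
open import Data.List.Relation.Binary.Sublist.Propositional using (_⊆_)
open import Data.Nat.Base using (ℕ; suc; _≤_)
open import Data.Product.Base using (∃; ∃-syntax; _×_; _,_)
open import Function.Bundles using (Bijection)
open import Relation.Binary.Bundles using (Setoid)
open import Relation.Binary.PropositionalEquality.Core using (_≡_; _≢_)
import Relation.Binary.PropositionalEquality.Properties as ≡
import Relation.Binary.Reasoning.Setoid as SetoidReasoning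
open import Relation.Nullary.Negation.Core using (¬_)
open import Relation.Unary using (Pred)

HasCardinality : {a ℓ : Level} → Setoid a ℓ → ℕ → Set (a ⊔ ℓ)
HasCardinality S n = Bijection S (≡.setoid (Fin n))

IsSmallest : {a : Level} → Pred ℕ a → ℕ → Set a
IsSmallest P m = P m × (∀ k → P k → m ≤ k)

IsLargest : {a : Level} → Pred ℕ a → ℕ → Set a
IsLargest P m = P m × (∀ k → P k → k ≤ m)

module _ {c ℓ : Level} (G : AbelianGroup c ℓ) where

  open AbelianGroup G
    renaming (_∙_ to infixl 6 _+_; ε to 0#; _⁻¹ to infix 8 -_)
    hiding (_-_)
  open RawMonoidDefinitions rawMonoid using () renaming (_×_ to _×ℕ_)

  HasOrder : ℕ → Set (c ⊔ ℓ)
  HasOrder n = HasCardinality setoid n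

  infixr 8 _×ℤ_
  _×ℤ_ : ℤ → Carrier → Carrier
  (+ n)    ×ℤ x = n ×ℕ x
  -[1+ n ] ×ℤ x = - (suc n ×ℕ x)

  IsCyclic : Set (c ⊔ ℓ)
  IsCyclic = ∃[ g ] ∀ x → ∃[ k ] x ≈ k ×ℤ g

  record Subgroup : Set (c ⊔ lsuc ℓ) where
    field
      Member   : Pred Carrier ℓ
      resp     : ∀ {x y} → x ≈ y → Member x → Member y
      0-closed : Member 0#
      +-closed : ∀ {x y} → Member x → Member y → Member (x + y)
      neg-closed : ∀ {x} → Member x → Member (- x)

  open Subgroup

  IsProper : Subgroup → Set (c ⊔ ℓ)
  IsProper H = ∃[ x ] ¬ Member H x

  Coset : Carrier → Subgroup → Pred Carrier (c ⊔ ℓ)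
  Coset α H x = ∃[ h ] (Member H h × x ≈ α + h)

  -- The quotient G/H has the elements of G, with x and y equal when x - y ∈ H.
  quotient : Subgroup → Setoid c ℓ
  quotient H = record
    { Carrier = Carrier
    ; _≈_ = λ x y → Member H (x + - y)
    ; isEquivalence = record
      { refl  = λ {x} → resp H (sym (inverseʳ x)) (0-closed H)
      ; sym   = λ {x} {y} p → resp H (neg-diff x y) (neg-closed H p)
      ; trans = λ {x} {y} {z} p q → resp H (add-diff x y z) (+-closed H p q)
      }
    }
    where
    open AbelianGroupProperties G using (⁻¹-∙-comm; ⁻¹-involutive)
    open SetoidReasoning setoid

    neg-diff : ∀ x y → - (x + - y) ≈ y + - x
    neg-diff x y = begin
      - (x + - y)    ≈⟨ ⁻¹-∙-comm x (- y) ⟨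
      - x + - (- y)  ≈⟨ ∙-congˡ (⁻¹-involutive y) ⟩
      - x + y        ≈⟨ comm (- x) y ⟩
      y + - x        ∎

    add-diff : ∀ x y z → (x + - y) + (y + - z) ≈ x + - z
    add-diff x y z = begin
      (x + - y) + (y + - z)  ≈⟨ assoc x (- y) (y + - z) ⟩
      x + (- y + (y + - z))  ≈⟨ ∙-congˡ (assoc (- y) y (- z)) ⟨
      x + ((- y + y) + - z)  ≈⟨ ∙-congˡ (∙-congʳ (inverseˡ y)) ⟩
      x + (0# + - z)         ≈⟨ ∙-congˡ (identityˡ (- z)) ⟩
      x + - z                ∎

  HasIndex : Subgroup → ℕ → Set (c ⊔ ℓ)
  HasIndex H k = HasCardinality (quotient H) k

  -- A sequence over G is a multiset, given here by a list enumerating it: its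
  -- length, its set of subsequence sums and hence everything below are
  -- unchanged when the list is permuted or its terms are replaced by
  -- ≈-equal ones.
  Sequence : Set c
  Sequence = List Carrier

  σ : Sequence → Carrier
  σ = foldr _+_ 0#

  Σ[_] : Sequence → Pred Carrier (c ⊔ ℓ)
  Σ[ T ] x = ∃[ S ] (S ⊆ T × S ≢ [] × x ≈ σ S)

  ZeroSumFree : Sequence → Set (c ⊔ ℓ)
  ZeroSumFree T = ¬ Σ[ T ] 0#

  Isd : ℕ → Set (c ⊔ ℓ)
  Isd = IsLargest λ k → ∃[ T ] (ZeroSumFree T × length T ≡ k)

  -- G• ∖ Σ(T) ⊆ α + H
  MissingIn : Sequence → Carrier → Subgroup → Set (c ⊔ ℓ)
  MissingIn T α H = ∀ x → ¬ (x ≈ 0#) → ¬ Σ[ T ] x → Coset α H x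

  Isν : ℕ → Set (c ⊔ lsuc ℓ)
  Isν = IsSmallest λ k → ∀ T → ZeroSumFree T → k ≤ length T →
    ∃[ H ] (IsProper H × ∃[ α ] (¬ Member H α × MissingIn T α H))

  Isνₚ : ℕ → ℕ → Set (c ⊔ lsuc ℓ)
  Isνₚ p = IsSmallest λ k → ∀ T → ZeroSumFree T → k ≤ length T →
    ∃[ H ] (HasIndex H p × ∃[ α ] (¬ Member H α × MissingIn T α H))

{-# OPTIONS --safe #-}

-- The prefix sums of a zero-sum free sequence T, the empty one included, are |T| + 1 distinct
-- elements, so |T| < n; if T has two distinct terms a, b side by side and s is the sum of the
-- terms before them, then s + b is one more. Hence for |T| ≥ n - 2 at most one nonzero element
-- is missing from Σ(T), and for nonempty T one is missing only if T = a^(n-2). Then it is - a,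
-- which lies outside the subgroup {x : (n/p) x = 0} of index p. Conversely, for a generator g
-- and k ≤ n - 3, g^k misses - g and - 2 g, and a subgroup containing their difference is all
-- of G.
module Submission where

open import Defs
open import Level using (Level; _⊔_)
open import Algebra.Bundles using (AbelianGroup)
import Algebra.Properties.AbelianGroup as AbelianGroupProperties
import Algebra.Properties.CommutativeMonoid.Mult as Mult
open import Data.Fin.Base using (Fin; zero; suc; toℕ; fromℕ<)
import Data.Fin.Properties as Fin
open import Data.Integer.Base using (+_; -[1+_])
open import Data.List.Base using ([]; _∷_; length; lookup; replicate; take)
open import Data.List.Properties using (length-replicate; length-take)
open import Data.List.Membership.Propositional.Properties using (∈-lookup)
open import Data.List.Relation.Binary.Sublist.Heterogeneous.Properties using (length-mono-≤)
open import Data.List.Relation.Binary.Sublist.Propositional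
  using (_⊆_; []; _∷_; _∷ʳ_; ⊆-refl; ⊆-trans; minimum)
open import Data.List.Relation.Binary.Sublist.Propositional.Properties using (All-resp-⊆; take-⊆)
open import Data.List.Relation.Unary.All as All using (All; []; _∷_)
import Data.List.Relation.Unary.All.Properties as All
open import Data.List.Relation.Unary.AllPairs using ([]; _∷_)
open import Data.List.Relation.Unary.Unique.Setoid using (Unique)
open import Data.Nat.Base using
  (ℕ; zero; suc; _≤_; _<_; _*_; _∸_; NonZero; s≤s; s≤s⁻¹; z<s;
   >-nonZero; >-nonZero⁻¹; nonTrivial⇒n>1)
  renaming (_+_ to _+ℕ_)
open import Data.Nat.Divisibility using (_∣_; divides)
open import Data.Nat.DivMod
open import Data.Nat.Primality using (Prime; prime⇒nonZero; prime⇒nonTrivial)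
import Data.Nat.Properties as ℕ
open import Data.Product.Base using (∃-syntax; _×_; _,_; proj₁; proj₂)
open import Data.Sum.Base using (_⊎_; inj₁; inj₂)
open import Function.Base using (_∘_)
open import Function.Bundles using (Bijection)
open import Relation.Binary.Definitions using (tri<; tri≈; tri>)
open import Relation.Binary.PropositionalEquality as ≡ using (_≡_; _≢_)
import Relation.Binary.Reasoning.Setoid as SetoidReasoning
open import Relation.Nullary using (¬_; Dec; yes; no; contradiction)
open import Relation.Nullary.Decidable using (map′)
open import Relation.Unary using (Pred)

module _ {c ℓ : Level} (G : AbelianGroup c ℓ) where

  open AbelianGroup G
    renaming (_∙_ to infixl 6 _+_; ε to 0#; _⁻¹ to infix 8 -_)
    hiding (_-_)
  open AbelianGroupProperties G
  open Mult commutativeMonoid renaming (_×_ to _×ℕ_)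
  open SetoidReasoning setoid

  -- Natural multiples of an element.

  x+y≈x⇒y≈0 : ∀ {x y} → x + y ≈ x → y ≈ 0#
  x+y≈x⇒y≈0 {x} {y} eq = ∙-cancelˡ x y 0# (trans eq (sym (identityʳ x)))

  ×ℕ-zeroʳ : ∀ m → m ×ℕ 0# ≈ 0#
  ×ℕ-zeroʳ zero    = refl
  ×ℕ-zeroʳ (suc m) = trans (identityˡ _) (×ℕ-zeroʳ m)

  ×ℕ-neg : ∀ m x → m ×ℕ (- x) ≈ - (m ×ℕ x)
  ×ℕ-neg m x = inverseˡ-unique _ _ (begin
    m ×ℕ (- x) + m ×ℕ x  ≈⟨ ×-distrib-+ (- x) x m ⟨
    m ×ℕ (- x + x)       ≈⟨ ×-congʳ m (inverseˡ x) ⟩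
    m ×ℕ 0#              ≈⟨ ×ℕ-zeroʳ m ⟩
    0#                   ∎)

  ×ℕ-∸ : ∀ {i j} x → i ≤ j → i ×ℕ x ≈ j ×ℕ x → (j ∸ i) ×ℕ x ≈ 0#
  ×ℕ-∸ {i} {j} x i≤j eq = x+y≈x⇒y≈0 {i ×ℕ x} (begin
    i ×ℕ x + (j ∸ i) ×ℕ x  ≈⟨ ×-homo-+ x i (j ∸ i) ⟨
    (i +ℕ (j ∸ i)) ×ℕ x    ≡⟨ ≡.cong (_×ℕ x) (ℕ.m+[n∸m]≡n i≤j) ⟩
    j ×ℕ x                 ≈⟨ eq ⟨
    i ×ℕ x                 ∎)

  ×ℕ-% : ∀ m d .{{_ : NonZero d}} {x} → d ×ℕ x ≈ 0# → m ×ℕ x ≈ (m % d) ×ℕ x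
  ×ℕ-% m d {x} dx≈0 = begin
    m ×ℕ x                                  ≡⟨ ≡.cong (_×ℕ x) (m≡m%n+[m/n]*n m d) ⟩
    (m % d +ℕ m / d * d) ×ℕ x               ≈⟨ ×-homo-+ x (m % d) (m / d * d) ⟩
    (m % d) ×ℕ x + (m / d * d) ×ℕ x         ≈⟨ ∙-congˡ (×-assocˡ x (m / d) d) ⟨
    (m % d) ×ℕ x + (m / d) ×ℕ (d ×ℕ x)      ≈⟨ ∙-congˡ (×-congʳ (m / d) dx≈0) ⟩
    (m % d) ×ℕ x + (m / d) ×ℕ 0#            ≈⟨ ∙-congˡ (×ℕ-zeroʳ (m / d)) ⟩
    (m % d) ×ℕ x + 0#                       ≈⟨ identityʳ _ ⟩
    (m % d) ×ℕ x                            ∎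

  σ-constant : ∀ {a S} → All (a ≈_) S → σ G S ≈ length S ×ℕ a
  σ-constant []         = refl
  σ-constant (a≈x ∷ as) = ∙-cong (sym a≈x) (σ-constant as)

  -- Elements as natural multiples of a generator.

  Generates : Carrier → Set (c ⊔ ℓ)
  Generates g = ∀ x → ∃[ k ] x ≈ _×ℤ_ G k g

  natural-multiple : ∀ {g d x} → Generates g → 0 < d → d ×ℕ g ≈ 0# → ∃[ m ] x ≈ m ×ℕ g
  natural-multiple {g} {suc d} {x} gen _ dg≈0 with gen x
  ... | + m , eq = m , eq
  -- Here `suc d` annihilates g, so the inverse of (m + 1) g is d (m + 1) g: the two add up to (m +
  -- 1) times (d + 1) g.
  ... | -[1+ m ] , eq = d * suc m , trans eq (sym (inverseʳ-unique (suc m ×ℕ g) _ (begin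
    suc m ×ℕ g + (d * suc m) ×ℕ g  ≈⟨ ×-homo-+ g (suc m) (d * suc m) ⟨
    (suc d * suc m) ×ℕ g           ≡⟨ ≡.cong (_×ℕ g) (ℕ.*-comm (suc d) (suc m)) ⟩
    (suc m * suc d) ×ℕ g           ≈⟨ ×-assocˡ g (suc m) (suc d) ⟨
    suc m ×ℕ (suc d ×ℕ g)          ≈⟨ ×-congʳ (suc m) dg≈0 ⟩
    suc m ×ℕ 0#                    ≈⟨ ×ℕ-zeroʳ (suc m) ⟩
    0#                             ∎)))

  reduced-multiple : ∀ {g d} → Generates g → 0 < d → d ×ℕ g ≈ 0# → ∀ x → ∃[ r ] (r < d × x ≈ r ×ℕ g)
  reduced-multiple {g} {d} gen 0<d dg≈0 x =
    let m , x≈mg = natural-multiple gen 0<d dg≈0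
        instance d≢0 = >-nonZero 0<d
    in m % d , m%n<n m d , trans x≈mg (×ℕ-% m d dg≈0)

  -- Distinct subsequence sums of a zero-sum free sequence.

  -- Subsequence sums, shifted by c₀, with the empty subsequence allowed.
  SubsumFrom : Carrier → Sequence G → Pred Carrier (c ⊔ ℓ)
  SubsumFrom c₀ T y = ∃[ S ] (S ⊆ T × y ≈ c₀ + σ G S)

  -- The list witnesses a lower bound k on the number of sums. The start `c₀` is variable because
  -- inductions along T absorb into it the terms already passed.
  SubsumsFrom : Carrier → Sequence G → ℕ → Set (c ⊔ ℓ)
  SubsumsFrom c₀ T k = ∃[ ys ] (Unique setoid ys × length ys ≡ k × All (SubsumFrom c₀ T) ys)

  subsum-start : ∀ {c₀ T} → SubsumFrom c₀ T c₀
  subsum-start = [] , minimum _ , sym (identityʳ _)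

  subsum-skip : ∀ {c₀ t T y} → SubsumFrom c₀ T y → SubsumFrom c₀ (t ∷ T) y
  subsum-skip (S , S⊆T , eq) = S , _ ∷ʳ S⊆T , eq

  subsum-take : ∀ {c₀ t T y} → SubsumFrom (c₀ + t) T y → SubsumFrom c₀ (t ∷ T) y
  subsum-take {t = t} (S , S⊆T , eq) = t ∷ S , ≡.refl ∷ S⊆T , trans eq (assoc _ _ _)

  zeroSumFree-⊆ : ∀ {S T} → S ⊆ T → ZeroSumFree G T → ZeroSumFree G S
  zeroSumFree-⊆ S⊆T zsf (R , R⊆S , ne , eq) = zsf (R , ⊆-trans R⊆S S⊆T , ne , eq)

  -- If `c₀` equalled `c₀ + t + σ S`, cancelling `c₀` would leave a vanishing sum of the nonempty
  -- subsequence `t ∷ S`.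
  start-avoided : ∀ {c₀ t T y} → ZeroSumFree G (t ∷ T) → SubsumFrom (c₀ + t) T y → ¬ (c₀ ≈ y)
  start-avoided {c₀} {t} zsf (S , S⊆T , y≈) c₀≈y =
    zsf (t ∷ S , ≡.refl ∷ S⊆T , (λ ()) , sym (x+y≈x⇒y≈0 {c₀}
      (trans (sym (assoc _ _ _)) (sym (trans c₀≈y y≈)))))

  -- The sums at hand all use `t`; by `start-avoided` the empty choice adds the new value `c₀`.
  subsums-cons : ∀ {c₀ t T k} → ZeroSumFree G (t ∷ T) →
                 SubsumsFrom (c₀ + t) T k → SubsumsFrom c₀ (t ∷ T) (suc k)
  subsums-cons {c₀} zsf (ys , uniq , len , all) =
    c₀ ∷ ys , All.map (start-avoided zsf) all ∷ uniq , ≡.cong suc len ,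
    subsum-start ∷ All.map subsum-take all

  prefix-sums : ∀ c₀ T → ZeroSumFree G T → SubsumsFrom c₀ T (suc (length T))
  prefix-sums c₀ []      zsf = c₀ ∷ [] , [] ∷ [] , ≡.refl , subsum-start ∷ []
  prefix-sums c₀ (t ∷ T) zsf =
    subsums-cons zsf (prefix-sums (c₀ + t) T (zeroSumFree-⊆ (t ∷ʳ ⊆-refl) zsf))

  -- Adjacent distinct terms a, b give, besides the prefix sums, the new sum c₀ + b.
  detour-sums : ∀ c₀ a b T → ¬ (a ≈ b) → ZeroSumFree G (a ∷ b ∷ T) →
                SubsumsFrom c₀ (a ∷ b ∷ T) (2 +ℕ length (a ∷ b ∷ T))
  detour-sums c₀ a b T a≉b zsf =
    c₀ ∷ (c₀ + b) ∷ (c₀ + a) ∷ ys ,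
    ((start-avoided zsf-b subsum-start ∷ start-avoided zsf subsum-start ∷
        All.map (start-avoided zsf ∘ subsum-take) all) ∷
     ((λ eq → a≉b (sym (∙-cancelˡ c₀ b a eq))) ∷
        All.map (start-avoided zsf-a ∘ swap) all) ∷
     All.map (start-avoided zsf-b) all ∷
     uniq) ,
    ≡.cong (3 +ℕ_) len ,
    subsum-start ∷ subsum-skip (subsum-take subsum-start) ∷ subsum-take subsum-start ∷
      All.map (subsum-take ∘ subsum-take) all
    where
    zsf-b : ZeroSumFree G (b ∷ T)
    zsf-b = zeroSumFree-⊆ (a ∷ʳ ⊆-refl) zsf

    zsf-a : ZeroSumFree G (a ∷ T)
    zsf-a = zeroSumFree-⊆ (≡.refl ∷ b ∷ʳ ⊆-refl) zsf

    prefixes : SubsumsFrom (c₀ + a + b) T (suc (length T))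
    prefixes = prefix-sums (c₀ + a + b) T (zeroSumFree-⊆ (b ∷ʳ ⊆-refl) zsf-b)

    ys   = proj₁ prefixes
    uniq = proj₁ (proj₂ prefixes)
    len  = proj₁ (proj₂ (proj₂ prefixes))
    all  = proj₂ (proj₂ (proj₂ prefixes))

    -- The later sums start at `c₀ + a + b`. Seen from `c₀ + b` they continue with `a`, so zero-sum
    -- freeness of `a ∷ T` separates them from `c₀ + b`.
    swap : ∀ {y} → SubsumFrom (c₀ + a + b) T y → SubsumFrom (c₀ + b + a) T y
    swap (S , S⊆T , eq) = S , S⊆T , trans eq (∙-congʳ (begin
      c₀ + a + b    ≈⟨ assoc c₀ a b ⟩
      c₀ + (a + b)  ≈⟨ ∙-congˡ (comm a b) ⟩
      c₀ + (b + a)  ≈⟨ assoc c₀ b a ⟨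
      c₀ + b + a    ∎))

  -- A nonconstant sequence has two adjacent distinct terms, which yield a detour. Each term in
  -- front of them adds one more sum, so the surplus over the prefix sums survives.
  constant⊎detour : (∀ x y → Dec (x ≈ y)) → ∀ c₀ a T → ZeroSumFree G (a ∷ T) →
    All (a ≈_) (a ∷ T) ⊎ SubsumsFrom c₀ (a ∷ T) (2 +ℕ length (a ∷ T))
  constant⊎detour _≟_ c₀ a []      zsf = inj₁ (refl ∷ [])
  constant⊎detour _≟_ c₀ a (b ∷ T) zsf with a ≟ b
  ... | no a≉b = inj₂ (detour-sums c₀ a b T a≉b zsf)
  ... | yes a≈b with constant⊎detour _≟_ (c₀ + a) b T (zeroSumFree-⊆ (a ∷ʳ ⊆-refl) zsf)
  ...   | inj₁ bs = inj₁ (refl ∷ All.map (trans a≈b) bs)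
  ...   | inj₂ ys = inj₂ (subsums-cons zsf ys)

  -- Constant sequences and missing elements.

  constant-multiple≉0 : ∀ {a T} → All (a ≈_) T → ZeroSumFree G T →
    ∀ i → 0 < i → i ≤ length T → ¬ (i ×ℕ a ≈ 0#)
  constant-multiple≉0 {a} {T} as zsf i 0<i i≤∣T∣ ia≈0 =
    -- The first i terms of the constant sequence would form a zero-sum subsequence.
    zsf (take i T , take-⊆ i T , nonempty , (begin
      0#                        ≈⟨ ia≈0 ⟨
      i ×ℕ a                    ≡⟨ ≡.cong (_×ℕ a) ∣take∣ ⟨
      length (take i T) ×ℕ a    ≈⟨ σ-constant (All-resp-⊆ (take-⊆ i T) as) ⟨
      σ G (take i T)            ∎))
    where
    ∣take∣ : length (take i T) ≡ i
    ∣take∣ = ≡.trans (length-take i T) (ℕ.m≤n⇒m⊓n≡m i≤∣T∣)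

    nonempty : take i T ≢ []
    nonempty eq = ℕ.<⇒≢ 0<i (≡.trans (≡.cong length (≡.sym eq)) ∣take∣)

  Missing : Sequence G → Pred Carrier (c ⊔ ℓ)
  Missing T x = ¬ (x ≈ 0#) × ¬ Σ[_] G T x

  -- From start 0 the empty subsequence gives 0 and the nonempty ones give Σ(T); a missing element
  -- is neither.
  missing-avoids : ∀ {T x y} → Missing T x → SubsumFrom 0# T y → ¬ (x ≈ y)
  missing-avoids (x≉0 , _)   ([]        , _   , eq) x≈y = x≉0 (trans x≈y (trans eq (identityˡ 0#)))
  missing-avoids (_   , x∉Σ) (S@(_ ∷ _) , S⊆T , eq) x≈y =
    x∉Σ (S , S⊆T , (λ ()) , trans x≈y (trans eq (identityˡ _)))

  nonempty-length : {S : Sequence G} → S ≢ [] → 0 < length S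
  nonempty-length {[]}    ne = contradiction ≡.refl ne
  nonempty-length {_ ∷ _} ne = z<s

  -- If - (j a) were a sum of i terms of T, then (j + i) a would vanish although 0 < j + i ≤ j +
  -- |T|.
  constant-missing : ∀ {a T} → All (a ≈_) T → ∀ j → 0 < j →
    (∀ i → 0 < i → i ≤ j +ℕ length T → ¬ (i ×ℕ a ≈ 0#)) → Missing T (- (j ×ℕ a))
  constant-missing {a} {T} as j 0<j nz =
    (λ eq → nz j 0<j (ℕ.m≤m+n j _)
      (trans (sym (⁻¹-involutive _)) (trans (⁻¹-cong eq) ε⁻¹≈ε))) ,
    λ (S , S⊆T , _ , eq) → nz (j +ℕ length S) (ℕ.≤-trans 0<j (ℕ.m≤m+n j _))
      (ℕ.+-monoʳ-≤ j (length-mono-≤ S⊆T)) (begin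
        (j +ℕ length S) ×ℕ a       ≈⟨ ×-homo-+ a j (length S) ⟩
        j ×ℕ a + length S ×ℕ a     ≈⟨ ∙-congˡ (σ-constant (All-resp-⊆ S⊆T as)) ⟨
        j ×ℕ a + σ G S             ≈⟨ ∙-congˡ eq ⟨
        j ×ℕ a + - (j ×ℕ a)        ≈⟨ inverseʳ _ ⟩
        0#                         ∎)

  -- Subgroups and their cosets.

  module _ (H : Subgroup G) where
    open Subgroup H

    ×ℕ-closed : ∀ {x} i → Member x → Member (i ×ℕ x)
    ×ℕ-closed zero    x∈H = 0-closed
    ×ℕ-closed (suc i) x∈H = +-closed x∈H (×ℕ-closed i x∈H)

    σ-closed : ∀ {S} → All Member S → Member (σ G S)
    σ-closed []          = 0-closed
    σ-closed (x∈H ∷ S∈H) = +-closed x∈H (σ-closed S∈H)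

    coset-self : ∀ {α x} → x ≈ α → Coset G α H x
    coset-self x≈α = 0# , 0-closed , trans x≈α (sym (identityʳ _))

    coset-diff : ∀ {α x y} → Coset G α H x → Coset G α H y → Member (x + - y)
    coset-diff {α} {x} {y} (h , h∈H , x≈) (k , k∈H , y≈) =
      resp (sym (begin
        x + - y                ≈⟨ ∙-cong x≈ (⁻¹-cong y≈) ⟩
        (α + h) + - (α + k)    ≈⟨ ∙-cong (comm h α) (⁻¹-∙-comm α k) ⟨
        (h + α) + (- α + - k)  ≈⟨ assoc h α _ ⟩
        h + (α + (- α + - k))  ≈⟨ ∙-congˡ (assoc α (- α) (- k)) ⟨
        h + ((α + - α) + - k)  ≈⟨ ∙-congˡ (∙-congʳ (inverseʳ α)) ⟩
        h + (0# + - k)         ≈⟨ ∙-congˡ (identityˡ (- k)) ⟩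
        h + - k                ∎))
      (+-closed h∈H (neg-closed k∈H))

  -- In a cyclic group of order q p with generator g, `torsion q` is the subgroup generated by p g,
  -- hence the one of index p. Defining it by an equation makes membership easy to test.
  torsion : ℕ → Subgroup G
  torsion m = record
    { Member     = λ x → m ×ℕ x ≈ 0#
    ; resp       = λ x≈y mx≈0 → trans (×-congʳ m (sym x≈y)) mx≈0
    ; 0-closed   = ×ℕ-zeroʳ m
    ; +-closed   = λ {x} {y} mx≈0 my≈0 →
        trans (×-distrib-+ x y m) (trans (∙-cong mx≈0 my≈0) (identityˡ 0#))
    ; neg-closed = λ {x} mx≈0 → trans (×ℕ-neg m x) (trans (⁻¹-cong mx≈0) ε⁻¹≈ε)
    }

  -- Counting distinct elements in a finite group.

  unique-lookup-injective : ∀ {ys} → Unique setoid ys → ∀ i j → lookup ys i ≈ lookup ys j → i ≡ j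
  unique-lookup-injective (y∉ ∷ u) zero    zero    eq = ≡.refl
  unique-lookup-injective (y∉ ∷ u) zero    (suc j) eq = contradiction eq (All.lookup y∉ (∈-lookup j))
  unique-lookup-injective (y∉ ∷ u) (suc i) zero    eq = contradiction (sym eq) (All.lookup y∉ (∈-lookup i))
  unique-lookup-injective (y∉ ∷ u) (suc i) (suc j) eq =
    ≡.cong suc (unique-lookup-injective u i j eq)

  module _ {n : ℕ} (order : HasOrder G n) where
    open Bijection order using (to; injective; surjective) renaming (cong to to-cong)

    _≟_ : ∀ x y → Dec (x ≈ y)
    x ≟ y = map′ injective to-cong (to x Fin.≟ to y)

    unique-length≤ : ∀ {ys} → Unique setoid ys → length ys ≤ n
    unique-length≤ {ys} u = Fin.injective⇒≤ {f = to ∘ lookup ys}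
      (λ eq → unique-lookup-injective u _ _ (injective eq))

    zeroSumFree-length< : ∀ {T} → ZeroSumFree G T → length T < n
    zeroSumFree-length< {T} zsf with prefix-sums 0# T zsf
    ... | _ , u , len , _ = ≡.subst (_≤ n) len (unique-length≤ u)

    -- The missing element differs from each of the k sums, so k + 1 distinct elements fit into G.
    subsums-missing : ∀ {T x k} → SubsumsFrom 0# T k → Missing T x → k < n
    subsums-missing (_ , u , ≡.refl , all) x-missing =
      unique-length≤ (All.map (missing-avoids x-missing) all ∷ u)

    -- Two distinct missing elements together with the |T| + 1 prefix sums would be |T| + 3 > n
    -- elements.
    missing-unique : ∀ {T x y} → ZeroSumFree G T → n ≤ 2 +ℕ length T →
      Missing T x → Missing T y → x ≈ y
    missing-unique {T} {x} {y} zsf n≤ x-missing y-missing with x ≟ y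
    ... | yes x≈y = x≈y
    ... | no x≉y with prefix-sums 0# T zsf
    ...   | _ , u , len , all = contradiction
      (≡.subst (λ k → 2 +ℕ k ≤ n) len (unique-length≤
        ((x≉y ∷ All.map (missing-avoids x-missing) all) ∷
         All.map (missing-avoids y-missing) all ∷ u)))
      (ℕ.≤⇒≯ n≤)

    -- Zero-sum free sequences of length at least n - 2.

    module _ (H : Subgroup G) {g : Carrier} (g∉H : ¬ Subgroup.Member H g)
             (annihilates : ∀ a → n ×ℕ a ≈ 0#) where
      open Subgroup H

      private
        AvoidingCoset : Sequence G → Set (c ⊔ ℓ)
        AvoidingCoset T = ∃[ α ] (¬ Member α × MissingIn G T α H)

        -- Together with a missing element, n or more sums would exceed the order. So nothing is
        -- missing, any coset other than H serves, and `g` represents one.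
        none-missing : ∀ {T k} → SubsumsFrom 0# T k → n ≤ k → AvoidingCoset T
        none-missing subsums n≤k = g , g∉H , λ x x≉0 x∉Σ →
          contradiction (subsums-missing subsums (x≉0 , x∉Σ)) (ℕ.≤⇒≯ n≤k)

        only-missing : ∀ {T α} → ZeroSumFree G T → n ≤ 2 +ℕ length T →
          Missing T α → ¬ Member α → AvoidingCoset T
        only-missing zsf n≤ α-missing α∉H = _ , α∉H , λ x x≉0 x∉Σ →
          coset-self H (missing-unique zsf n≤ (x≉0 , x∉Σ) α-missing)

      -- If every term of T is a, the only element missed is - a. Were a in H, then
      -- so would be Σ(T), and g would be missed as well.
      constant-avoidingCoset : ∀ {a T} → All (a ≈_) T → 0 < length T → ZeroSumFree G T →
        n ≡ 2 +ℕ length T → AvoidingCoset T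
      constant-avoidingCoset {a} {T} as 0<∣T∣ zsf n≡ =
        only-missing zsf (ℕ.≤-reflexive n≡) -a-missing -a∉H
        where
        multiple≉0 : ∀ i → 0 < i → i ≤ suc (length T) → ¬ (i ×ℕ a ≈ 0#)
        multiple≉0 i 0<i i≤ ia≈0 with ℕ.m≤n⇒m<n∨m≡n i≤
        ... | inj₁ (s≤s i≤∣T∣) = constant-multiple≉0 as zsf i 0<i i≤∣T∣ ia≈0
        -- If (|T| + 1) a = 0, then a = (|T| + 2) a = n a = 0, contradicting that the single term a
        -- is not a zero-sum subsequence.
        ... | inj₂ ≡.refl = constant-multiple≉0 as zsf 1 z<s 0<∣T∣ (begin
          a + 0#                    ≈⟨ ∙-congˡ ia≈0 ⟨
          (2 +ℕ length T) ×ℕ a      ≡⟨ ≡.cong (_×ℕ a) n≡ ⟨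
          n ×ℕ a                    ≈⟨ annihilates a ⟩
          0#                        ∎)

        -a-missing : Missing T (- (1 ×ℕ a))
        -a-missing = constant-missing as 1 z<s multiple≉0

        -a∉H : ¬ Member (- (1 ×ℕ a))
        -a∉H -a∈H = g∉H (resp (missing-unique zsf (ℕ.≤-reflexive n≡) -a-missing g-missing) -a∈H)
          where
          a∈H : Member a
          a∈H = resp (trans (⁻¹-involutive _) (identityʳ a)) (neg-closed -a∈H)

          g-missing : Missing T g
          g-missing =
            (λ g≈0 → g∉H (resp (sym g≈0) 0-closed)) ,
            λ (S , S⊆T , _ , g≈σS) → g∉H (resp (sym g≈σS)
              (σ-closed H (All.map (λ a≈x → resp a≈x a∈H) (All-resp-⊆ S⊆T as))))

      -- For empty T the element `g` is missing, and n ≤ 2 makes it the only one. A nonconstant T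
      -- has |T| + 2 ≥ n sums, and a T of length at least n - 1 has n prefix sums, so nothing is
      -- missing. There remains a constant T of length n - 2. Since H is any subgroup that avoids
      -- some `g`, one choice of H of index p serves ν and νₚ alike.
      avoidingCoset : ∀ {T} → ZeroSumFree G T → n ≤ 2 +ℕ length T → AvoidingCoset T
      avoidingCoset {[]} zsf n≤ = only-missing zsf n≤
        ((λ g≈0 → g∉H (resp (sym g≈0) 0-closed)) , λ { (_ , [] , ne , _) → ne ≡.refl }) g∉H
      avoidingCoset {a ∷ T} zsf n≤ with constant⊎detour _≟_ 0# a T zsf
      ... | inj₂ subsums = none-missing subsums n≤
      ... | inj₁ as with ℕ.m≤n⇒m<n∨m≡n n≤
      ...   | inj₁ (s≤s n≤1+∣T∣) = none-missing (prefix-sums 0# (a ∷ T) zsf) n≤1+∣T∣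
      ...   | inj₂ n≡ = constant-avoidingCoset as z<s zsf n≡

    -- The order of a generator and discrete logarithms.

    module _ {g : Carrier} (gen : Generates g) where

      -- If d g = 0, every element is r g for some r < d, and r determines the element; thus G
      -- injects into `Fin d`.
      order-minimal : ∀ d → 0 < d → d ×ℕ g ≈ 0# → n ≤ d
      order-minimal d 0<d dg≈0 = Fin.injective⇒≤ {f = residue} residue-injective
        where
        from : Fin n → Carrier
        from i = proj₁ (surjective i)

        reduced : ∀ i → ∃[ r ] (r < d × from i ≈ r ×ℕ g)
        reduced i = reduced-multiple gen 0<d dg≈0 (from i)

        residue : Fin n → Fin d
        residue i = fromℕ< (proj₁ (proj₂ (reduced i)))

        residue-injective : ∀ {i j} → residue i ≡ residue j → i ≡ j
        residue-injective {i} {j} eq =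
          ≡.trans (≡.sym (proj₂ (surjective i) refl)) (≡.trans (to-cong (begin
            from i                    ≈⟨ proj₂ (proj₂ (reduced i)) ⟩
            proj₁ (reduced i) ×ℕ g    ≡⟨ ≡.cong (_×ℕ g) (Fin.fromℕ<-injective _ _ _ _ eq) ⟩
            proj₁ (reduced j) ×ℕ g    ≈⟨ proj₂ (proj₂ (reduced j)) ⟨
            from j                    ∎)) (proj₂ (surjective j) refl))

      -- Among the n + 1 multiples 0 g, ..., n g two coincide, so their difference d ≤ n annihilates
      -- g; minimality forces d = n.
      order-annihilates : n ×ℕ g ≈ 0#
      order-annihilates with Fin.pigeonhole (ℕ.n<1+n n) (λ i → to (toℕ i ×ℕ g))
      ... | i , j , i<j , eq = ≡.subst (λ d → d ×ℕ g ≈ 0#) d≡n dg≈0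
        where
        d = toℕ j ∸ toℕ i

        dg≈0 : d ×ℕ g ≈ 0#
        dg≈0 = ×ℕ-∸ g (ℕ.<⇒≤ i<j) (injective eq)

        d≡n : d ≡ n
        d≡n = ℕ.≤-antisym (ℕ.≤-trans (ℕ.m∸n≤m (toℕ j) (toℕ i)) (Fin.toℕ≤pred[n] j))
          (order-minimal d (ℕ.m<n⇒0<n∸m i<j) dg≈0)

      multiple≉0 : ∀ i → 0 < i → i < n → ¬ (i ×ℕ g ≈ 0#)
      multiple≉0 i 0<i i<n ig≈0 = ℕ.<⇒≱ i<n (order-minimal i 0<i ig≈0)

      module _ (0<n : 0 < n) where
        private instance
          n≢0 : NonZero n
          n≢0 = >-nonZero 0<n

        all-annihilated : ∀ x → n ×ℕ x ≈ 0#
        all-annihilated x with natural-multiple gen 0<n order-annihilates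
        ... | m , x≈mg = begin
          n ×ℕ x            ≈⟨ ×-congʳ n x≈mg ⟩
          n ×ℕ (m ×ℕ g)     ≈⟨ ×-assocˡ g n m ⟩
          (n * m) ×ℕ g      ≡⟨ ≡.cong (_×ℕ g) (ℕ.*-comm n m) ⟩
          (m * n) ×ℕ g      ≈⟨ ×-assocˡ g m n ⟨
          m ×ℕ (n ×ℕ g)     ≈⟨ ×-congʳ m order-annihilates ⟩
          m ×ℕ 0#           ≈⟨ ×ℕ-zeroʳ m ⟩
          0#                ∎

        reduced-injective : ∀ {i j} → i < n → j < n → i ×ℕ g ≈ j ×ℕ g → i ≡ j
        reduced-injective {i} {j} i<n j<n eq with ℕ.<-cmp i j
        ... | tri≈ _ i≡j _ = i≡j
        ... | tri< i<j _ _ = contradiction (×ℕ-∸ g (ℕ.<⇒≤ i<j) eq)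
          (multiple≉0 _ (ℕ.m<n⇒0<n∸m i<j) (ℕ.≤-<-trans (ℕ.m∸n≤m j i) j<n))
        ... | tri> _ _ j<i = contradiction (×ℕ-∸ g (ℕ.<⇒≤ j<i) (sym eq))
          (multiple≉0 _ (ℕ.m<n⇒0<n∸m j<i) (ℕ.≤-<-trans (ℕ.m∸n≤m i j) i<n))

        multiple-≈⇒%-≡ : ∀ {i j} → i ×ℕ g ≈ j ×ℕ g → i % n ≡ j % n
        multiple-≈⇒%-≡ {i} {j} eq = reduced-injective (m%n<n i n) (m%n<n j n) (begin
          (i % n) ×ℕ g    ≈⟨ ×ℕ-% i n order-annihilates ⟨
          i ×ℕ g          ≈⟨ eq ⟩
          j ×ℕ g          ≈⟨ ×ℕ-% j n order-annihilates ⟩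
          (j % n) ×ℕ g    ∎)

        %-≡⇒multiple-≈ : ∀ {i j} → i % n ≡ j % n → i ×ℕ g ≈ j ×ℕ g
        %-≡⇒multiple-≈ {i} {j} eq = begin
          i ×ℕ g          ≈⟨ ×ℕ-% i n order-annihilates ⟩
          (i % n) ×ℕ g    ≡⟨ ≡.cong (_×ℕ g) eq ⟩
          (j % n) ×ℕ g    ≈⟨ ×ℕ-% j n order-annihilates ⟨
          j ×ℕ g          ∎

        -- A discrete logarithm to base g. It may vary with the representative of x, and only its
        -- residue modulo n is guaranteed to respect `≈`.
        log : Carrier → ℕ
        log x = proj₁ (natural-multiple {x = x} gen 0<n order-annihilates)

        log-correct : ∀ x → x ≈ log x ×ℕ g
        log-correct x = proj₂ (natural-multiple gen 0<n order-annihilates)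

        -- Sequences that repeat a generator.

        replicate-zeroSumFree : ∀ {k} → k < n → ZeroSumFree G (replicate k g)
        replicate-zeroSumFree {k} k<n (S , S⊆ , ne , 0≈σS) =
          multiple≉0 (length S) (nonempty-length ne)
            (ℕ.≤-<-trans (≡.subst (length S ≤_) (length-replicate k) (length-mono-≤ S⊆)) k<n)
            (trans (sym (σ-constant (All-resp-⊆ S⊆ (All.replicate⁺ k refl)))) (sym 0≈σS))

        replicate-missing : ∀ {k} j → 0 < j → j +ℕ k < n → Missing (replicate k g) (- (j ×ℕ g))
        replicate-missing {k} j 0<j j+k<n = constant-missing (All.replicate⁺ k refl) j 0<j
          λ i 0<i i≤ → multiple≉0 i 0<i (ℕ.≤-<-trans
            (≡.subst (λ l → i ≤ j +ℕ l) (length-replicate k) i≤) j+k<n)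

        -- The sequence misses both - g and - 2 g, whose difference is g.
        replicate-no-avoidingCoset : ∀ {k} → 2 +ℕ k < n → ∀ H α → ¬ Subgroup.Member H α →
          ¬ MissingIn G (replicate k g) α H
        replicate-no-avoidingCoset {k} 2+k<n H α α∉H missing⊆ =
          α∉H (resp (sym (log-correct α)) (×ℕ-closed H (log α) g∈H))
          where
          open Subgroup H

          in-coset : ∀ j → 0 < j → j +ℕ k < n → Coset G α H (- (j ×ℕ g))
          in-coset j 0<j j+k<n =
            let ≉0 , ∉Σ = replicate-missing j 0<j j+k<n in missing⊆ _ ≉0 ∉Σ

          g∈H : Member g
          g∈H = resp
            (begin
              - (1 ×ℕ g) + - (- (2 ×ℕ g))  ≈⟨ ∙-cong (⁻¹-cong (identityʳ g)) (⁻¹-involutive _) ⟩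
              - g + (g + (g + 0#))         ≈⟨ assoc (- g) g _ ⟨
              - g + g + (g + 0#)           ≈⟨ ∙-cong (inverseˡ g) (identityʳ g) ⟩
              0# + g                       ≈⟨ identityˡ g ⟩
              g                            ∎)
            -- The strictness of `2+k<n` is what the case j = 2 demands: no positive multiple of g
            -- up to (k + 2) g may vanish.
            (coset-diff H (in-coset 1 z<s (ℕ.<-trans (ℕ.n<1+n _) 2+k<n)) (in-coset 2 z<s 2+k<n))

        -- The index of the torsion subgroup.

        module _ {q p : ℕ} .{{_ : NonZero q}} .{{_ : NonZero p}} (n≡q*p : n ≡ q * p) where

          private
            instance
              p*q≢0 : NonZero (p * q)
              p*q≢0 = ℕ.m*n≢0 p q

            ×ℕ-multiple : ∀ i → q ×ℕ (i ×ℕ g) ≈ (i * q) ×ℕ g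
            ×ℕ-multiple i = trans (×-assocˡ g q i) (×-congˡ (ℕ.*-comm q i))

            -- Scaling by q turns residues modulo p into residues modulo n = p q, which are the ones
            -- that decide equality of multiples of g.
            scaled-% : ∀ i → (i * q) % n ≡ (i % p) * q
            scaled-% i = ≡.trans (%-congʳ {m = n} {n = p * q} (≡.trans n≡q*p (ℕ.*-comm q p)))
              (≡.sym (m%n*o≡m*o%[n*o] i p q))

          -- Both sides are multiples of g, so i q and j q agree modulo n, and the common factor q
          -- cancels. With the converse below, i and j agree modulo p exactly when i g and j g lie
          -- in the same coset of `torsion q`.
          torsion-≈⇒%-≡ : ∀ {i j} → q ×ℕ (i ×ℕ g) ≈ q ×ℕ (j ×ℕ g) → i % p ≡ j % p
          torsion-≈⇒%-≡ {i} {j} eq = ℕ.*-cancelʳ-≡ (i % p) (j % p) q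
            (≡.trans (≡.sym (scaled-% i)) (≡.trans
              (multiple-≈⇒%-≡ {i * q} {j * q}
                (trans (sym (×ℕ-multiple i)) (trans eq (×ℕ-multiple j))))
              (scaled-% j)))

          %-≡⇒torsion-≈ : ∀ {i j} → i % p ≡ j % p → q ×ℕ (i ×ℕ g) ≈ q ×ℕ (j ×ℕ g)
          %-≡⇒torsion-≈ {i} {j} eq = trans (×ℕ-multiple i) (trans
            (%-≡⇒multiple-≈ {i * q} {j * q}
              (≡.trans (scaled-% i) (≡.trans (≡.cong (_* q) eq) (≡.sym (scaled-% j)))))
            (sym (×ℕ-multiple j)))

          torsion-diff⇒≈ : ∀ x y → q ×ℕ (x + - y) ≈ 0# → q ×ℕ x ≈ q ×ℕ y
          torsion-diff⇒≈ x y eq = x∙y⁻¹≈ε⇒x≈y (q ×ℕ x) (q ×ℕ y) (begin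
            q ×ℕ x + - (q ×ℕ y)    ≈⟨ ∙-congˡ (×ℕ-neg q y) ⟨
            q ×ℕ x + q ×ℕ (- y)    ≈⟨ ×-distrib-+ x (- y) q ⟨
            q ×ℕ (x + - y)         ≈⟨ eq ⟩
            0#                     ∎)

          ≈⇒torsion-diff : ∀ x y → q ×ℕ x ≈ q ×ℕ y → q ×ℕ (x + - y) ≈ 0#
          ≈⇒torsion-diff x y eq = begin
            q ×ℕ (x + - y)         ≈⟨ ×-distrib-+ x (- y) q ⟩
            q ×ℕ x + q ×ℕ (- y)    ≈⟨ ∙-congˡ (×ℕ-neg q y) ⟩
            q ×ℕ x + - (q ×ℕ y)    ≈⟨ x≈y⇒x∙y⁻¹≈ε eq ⟩
            0#                     ∎

          -- The coset of x corresponds to the residue of its logarithm modulo p, and the residue k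
          -- is attained at k g.
          torsion-index : HasIndex G (torsion q) p
          torsion-index = record
            { to        = residue
            ; cong      = λ {x} {y} → residue-cong x y
            ; bijective = (λ {x} {y} → residue-injective x y) , residue-surjective
            }
            where
            residue : Carrier → Fin p
            residue x = fromℕ< (m%n<n (log x) p)

            ×ℕ-log : ∀ x → q ×ℕ x ≈ q ×ℕ (log x ×ℕ g)
            ×ℕ-log x = ×-congʳ q (log-correct x)

            residue-cong : ∀ x y → q ×ℕ (x + - y) ≈ 0# → residue x ≡ residue y
            residue-cong x y eq = Fin.fromℕ<-cong _ _ (torsion-≈⇒%-≡ {log x} {log y}
              (trans (sym (×ℕ-log x)) (trans (torsion-diff⇒≈ x y eq) (×ℕ-log y)))) _ _

            residue-injective : ∀ x y → residue x ≡ residue y → q ×ℕ (x + - y) ≈ 0#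
            residue-injective x y eq = ≈⇒torsion-diff x y (trans (×ℕ-log x) (trans
              (%-≡⇒torsion-≈ {log x} {log y} (Fin.fromℕ<-injective _ _ _ _ eq)) (sym (×ℕ-log y))))

            residue-multiple : ∀ (k : Fin p) → residue (toℕ k ×ℕ g) ≡ k
            residue-multiple k = Fin.toℕ-injective (≡.trans (Fin.toℕ-fromℕ< _) (≡.trans
              (torsion-≈⇒%-≡ {log (toℕ k ×ℕ g)} {toℕ k} (sym (×ℕ-log (toℕ k ×ℕ g))))
              (m<n⇒m%n≡m (Fin.toℕ<n k))))

            residue-surjective : ∀ k → ∃[ x ] (∀ {z} → q ×ℕ (z + - x) ≈ 0# → residue z ≡ k)
            residue-surjective k = toℕ k ×ℕ g , λ {z} eq →
              ≡.trans (residue-cong z (toℕ k ×ℕ g) eq) (residue-multiple k)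

proposition3p3 : {c ℓ : Level} (G : AbelianGroup c ℓ) (n : ℕ) →
    HasOrder G n → IsCyclic G → 2 ≤ n →
    (p : ℕ) → Prime p → p ∣ n →
    ∃[ ν ] ∃[ νₚ ] ∃[ d ]
    (Isν G ν × Isνₚ G p νₚ × Isd G d × ν ≡ νₚ × suc νₚ ≡ d)
proposition3p3 G n@(suc (suc m)) order (g , gen) (s≤s (s≤s _)) p p-prime (divides q n≡q*p) =
  -- As n = m + 2, these are ν = νₚ = n - 2 and d = n - 1.
  m , m , suc m ,
  ( (λ T zsf m≤ → H , (g , g∉H) , coset zsf m≤)
  , λ k property → minimal k λ T zsf k≤ →
      let H , _ , α , α∉H , missing⊆ = property T zsf k≤ in H , α , α∉H , missing⊆) ,
  ( (λ T zsf m≤ → H , torsion-index G order gen z<s n≡q*p , coset zsf m≤)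
  , λ k property → minimal k λ T zsf k≤ →
      let H , _ , α , α∉H , missing⊆ = property T zsf k≤ in H , α , α∉H , missing⊆) ,
  -- The length n - 1 is attained by repeating g, and counting prefix sums forbids anything longer.
  ( (replicate (suc m) g , replicate-zeroSumFree G order gen z<s ℕ.≤-refl , length-replicate (suc m))
  , λ { _ (T , zsf , ≡.refl) → s≤s⁻¹ (zeroSumFree-length< G order zsf) }) ,
  ≡.refl , ≡.refl
  where
  instance
    p≢0 : NonZero p
    p≢0 = prime⇒nonZero p-prime

    q*p≢0 : NonZero (q * p)
    q*p≢0 = ≡.subst NonZero n≡q*p _

    q≢0 : NonZero q
    q≢0 = ℕ.m*n≢0⇒m≢0 q

  H : Subgroup G
  H = torsion G q

  q<n : q < n
  q<n = ≡.subst (q <_) (≡.sym n≡q*p)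
    (ℕ.m<m*n q p (nonTrivial⇒n>1 p {{prime⇒nonTrivial p-prime}}))

  g∉H : ¬ Subgroup.Member H g
  g∉H = multiple≉0 G order gen q (>-nonZero⁻¹ q) q<n

  coset : ∀ {T} → ZeroSumFree G T → m ≤ length T →
    ∃[ α ] (¬ Subgroup.Member H α × MissingIn G T α H)
  coset zsf m≤ = avoidingCoset G order H g∉H (all-annihilated G order gen z<s) zsf (s≤s (s≤s m≤))

  -- For k < n - 2 the sequence repeating g k times violates the property. Asking of H only that it
  -- omit α lets this bound apply to both ν and νₚ.
  minimal : ∀ k →
    (∀ T → ZeroSumFree G T → k ≤ length T →
      ∃[ H ] ∃[ α ] (¬ Subgroup.Member H α × MissingIn G T α H)) → m ≤ k
  minimal k property = ℕ.≮⇒≥ λ k<m →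
    let 2+k<n = s≤s (s≤s k<m)
        H , α , α∉H , missing⊆ = property (replicate k g)
          (replicate-zeroSumFree G order gen z<s (ℕ.<-trans (ℕ.n<1+n k) (ℕ.<-trans (ℕ.n<1+n _) 2+k<n)))
          (ℕ.≤-reflexive (≡.sym (length-replicate k)))
    in replicate-no-avoidingCoset G order gen z<s 2+k<n H α α∉H missing⊆
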